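{- Let $T=\{t_1,\ldots,t_N\}$ be documents, each containing at most $L$ distinct words from a dictionary $\{w_1,\ldots,w_D\}$, and let $\#(w)$ denote the number of documents containing word $w$. Let $h_1,\ldots,h_k$ be hash functions such that the values $h_j(t)$, over all $j$ and all documents $t$, are independent and uniformly distributed on $[0,1]$. For a word $w$ and hash function $h$, let $g(w)=\min_{t\,:\,w\in t}h(t)$ (the MinHash of $w$ under $h$). Consider the mapper MinHashSampleMap which, for each document $t$, each word $w$ in $t$, and each $j=1,\ldots,k$, emits $((w,j)\to h_j(t))$ if and only if $h_j(t)\le\frac{c\log(Dk)}{\#(w)}$, with $c=3$. Then with probability at least $1-\frac{1}{(Dk)^2}$, for all words $w$ and all hash functions $h\in\{h_1,\ldots,h_k\}$, MinHashSampleMap emits the hash value of the document that realizes $g(w)$.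
   Context: $\log$ denotes the natural logarithm. -}

module Defs where

open import Algebra.Bundles using (CommutativeRing; Semiring)
open import Data.Fin.Base using (Fin; toℕ)
open import Data.Fin.Subset using (Subset; _∈_)
open import Data.Fin.Subset.Properties using (_∈?_)
open import Data.List.Base using (allFin; filter; length)
open import Data.Nat.Base as ℕ using (ℕ; _!)
open import Data.Product.Base using (∃-syntax; _×_; _,_)
open import Level using (0ℓ) renaming (suc to lsuc)
open import Relation.Binary.Core using (Rel)
open import Relation.Binary.PropositionalEquality.Core using (_≢_)
open import Relation.Binary.Structures using (IsTotalOrder)
open import Relation.Nullary.Negation.Core using (¬_)
open import Relation.Unary using (Pred; U; ∁; ⋃; _≐_; _⊥_)

import Algebra.Definitions.RawSemiring as RawSemiringDefs
import Relation.Binary.Construct.NonStrictToStrict as Strict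

-- The real numbers: a Dedekind-complete totally ordered field, which is
-- unique up to isomorphism.  As usual for total operations, _⁻¹ is
-- unconstrained at 0, and sup on empty or unbounded sets.
record CompleteOrderedField : Set₁ where
  infix  8 _⁻¹
  infixl 7 _/_
  infix  4 _≤_ _⟶_
  field
    commutativeRing : CommutativeRing 0ℓ 0ℓ
  open CommutativeRing commutativeRing public renaming (Carrier to ℝ)
  field
    _≤_          : Rel ℝ 0ℓ
    isTotalOrder : IsTotalOrder _≈_ _≤_
    +-monoˡ-≤    : ∀ z {x y} → x ≤ y → x + z ≤ y + z
    *-nonneg     : ∀ {x y} → 0# ≤ x → 0# ≤ y → 0# ≤ x * y
    0≉1          : ¬ (0# ≈ 1#)
    _⁻¹          : ℝ → ℝ
    ⁻¹-cong      : ∀ {x y} → x ≈ y → x ⁻¹ ≈ y ⁻¹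
    *-inverseʳ   : ∀ {x} → ¬ (x ≈ 0#) → x * x ⁻¹ ≈ 1#
    sup          : Pred ℝ 0ℓ → ℝ
    sup-upper    : ∀ S {b} → (∀ {x} → S x → x ≤ b) →
                   ∀ {x} → S x → x ≤ sup S
    sup-least    : ∀ S {b} → (∃[ x ] S x) → (∀ {x} → S x → x ≤ b) →
                   sup S ≤ b

  open Strict _≈_ _≤_ public using (_<_)
  open RawSemiringDefs (Semiring.rawSemiring semiring) public
    using (sum; product; _^_) renaming (_×_ to _·_)

  _/_ : ℝ → ℝ → ℝ
  x / y = x * y ⁻¹

  fromℕ : ℕ → ℝ
  fromℕ n = n · 1#

  _⟶_ : (ℕ → ℝ) → ℝ → Set
  a ⟶ l = ∀ ε → 0# < ε →
    ∃[ m ] ∀ n → m ℕ.≤ n → (l - ε ≤ a n) × (a n ≤ l + ε)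

  -- The lower limit, hence the limit of every convergent sequence.
  lim : (ℕ → ℝ) → ℝ
  lim a = sup λ b → ∃[ m ] ∀ n → m ℕ.≤ n → b ≤ a n

  exp : ℝ → ℝ
  exp x = lim λ n → sum {n} λ i → x ^ toℕ i / fromℕ (toℕ i !)

  -- Inverse of exp on the positive reals.
  log : ℝ → ℝ
  log x = sup λ y → exp y ≤ x

record IsσAlgebra {X : Set} (E : Pred (Pred X 0ℓ) (lsuc 0ℓ)) : Set₁ where
  field
    resp  : ∀ {A B} → A ≐ B → E A → E B
    univ  : E U
    compl : ∀ {A} → E A → E (∁ A)
    union : ∀ {A : ℕ → Pred X 0ℓ} → (∀ n → E (A n)) → E (⋃ ℕ A)

module _ (R : CompleteOrderedField) where
  open CompleteOrderedField R

  data Borel : Pred (Pred ℝ 0ℓ) (lsuc 0ℓ) where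
    ray   : ∀ a → Borel (λ x → x ≤ a)
    resp  : ∀ {A B} → A ≐ B → Borel A → Borel B
    univ  : Borel U
    compl : ∀ {A} → Borel A → Borel (∁ A)
    union : ∀ {A : ℕ → Pred ℝ 0ℓ} → (∀ n → Borel (A n)) → Borel (⋃ ℕ A)

  -- P is total for convenience; nothing is assumed outside the events.
  record ProbabilitySpace : Set₂ where
    field
      Ω          : Set
      IsEvent    : Pred (Pred Ω 0ℓ) (lsuc 0ℓ)
      isσAlgebra : IsσAlgebra IsEvent
      P          : Pred Ω 0ℓ → ℝ
      P-cong     : ∀ {A B} → IsEvent A → A ≐ B → P A ≈ P B
      P-nonneg   : ∀ {A} → IsEvent A → 0# ≤ P A
      P-univ     : P U ≈ 1#
      P-union    : ∀ {A : ℕ → Pred Ω 0ℓ} → (∀ n → IsEvent (A n)) →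
                   (∀ {m n} → m ≢ n → A m ⊥ A n) →
                   (λ n → sum {n} λ i → P (A (toℕ i))) ⟶ P (⋃ ℕ A)

    IsRandomVariable : (Ω → ℝ) → Set₁
    IsRandomVariable X = ∀ {B} → Borel B → IsEvent (λ ω → B (X ω))

    IsUniform[0,1] : (Ω → ℝ) → Set
    IsUniform[0,1] X = ∀ {a b} → 0# ≤ a → a ≤ b → b ≤ 1# →
      P (λ ω → a ≤ X ω × X ω ≤ b) ≈ b - a

    -- Mutual independence of a finite doubly indexed family; taking some
    -- of the B i j to be U gives the product rule for subfamilies.
    Independent : ∀ {m n : ℕ} → (Fin m → Fin n → Ω → ℝ) → Set₁
    Independent {m} {n} X = (B : Fin m → Fin n → Pred ℝ 0ℓ) → (∀ i j → Borel (B i j)) →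
      P (λ ω → ∀ i j → B i j (X i j ω)) ≈
      product λ i → product λ j → P (λ ω → B i j (X i j ω))

-- Documents t : Fin N over the dictionary Fin D; T t is the set of
-- distinct words of document t.
module _ {N D : ℕ} (T : Fin N → Subset D) where

  #_ : Fin D → ℕ
  # w = length (filter (λ t → w ∈? T t) (allFin N))

  module _ (R : CompleteOrderedField) where
    open CompleteOrderedField R

    record IsMinHash (h : Fin N → ℝ) (w : Fin D) (g : ℝ) : Set where
      field
        attained   : ∃[ t ] (w ∈ T t × h t ≈ g)
        lowerBound : ∀ t → w ∈ T t → g ≤ h t

    -- The key-value pairs emitted for document t.
    data MinHashSampleMap (c : ℝ) {k : ℕ} (h : Fin k → Fin N → ℝ) (t : Fin N) :
                          Fin D × Fin k → ℝ → Set where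
      emit : ∀ w j → w ∈ T t →
             h j t ≤ (c * log (fromℕ (D ℕ.* k))) / fromℕ (# w) →
             MinHashSampleMap c h t (w , j) (h j t)

    -- g(w) exists only for words occurring in some document.  Documents
    -- tied for the minimum have the same hash value.
    EmitsAllMinHashes : (c : ℝ) {k : ℕ} → (Fin k → Fin N → ℝ) → Set
    EmitsAllMinHashes c h = ∀ w → (∃[ t ] w ∈ T t) → ∀ j →
      ∃[ t ] (w ∈ T t × IsMinHash (h j) w (h j t) ×
              MinHashSampleMap c h t (w , j) (h j t))

{-# OPTIONS --safe #-}

-- The minimum of h_j over the n = #(w) documents containing w is missed iff all n
-- hash values exceed the threshold p, which has probability at most (1 − r)ⁿ with
-- r = min(p, 1), by independence.  For p < 1 this is at most (Dk)⁻³, and the union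
-- bound over the Dk pairs (w, j) gives (Dk)⁻².
--
-- Since log is defined as a supremum, (1 − p)ⁿ ≤ x⁻³ for p = 3 log x / n is derived
-- from the partial sums Sₘ of the exponential series alone: termwise comparison gives
-- Sₘ(a + u)(1 − u) ≤ Sₘ(a), hence Sₘ(nu + d)(1 − d)(1 − u)ⁿ ≤ 1, and with nu = log x
-- and d → 0 this yields x (1 − u)ⁿ ≤ 1.  Bernoulli's 1 − 3u ≤ (1 − u)³ does the rest.

module Submission where

open import Defs
open import Algebra.Bundles using (CommutativeRing)
open import Algebra.Solver.Ring.AlmostCommutativeRing
  using (fromCommutativeRing; Induced-equivalence; _-Raw-AlmostCommutative⟶_)
open import Axiom.ExcludedMiddle using (ExcludedMiddle)
open import Data.Empty using (⊥-elim)
open import Data.Fin.Base using (Fin; zero; suc; toℕ)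
open import Data.Fin.Subset using (Subset; ∣_∣; _∈_)
open import Data.Fin.Subset.Properties using (_∈?_)
open import Data.Integer.Base as ℤ using (ℤ; +_; -[1+_]; _⊖_)
open import Data.List.Base using (filter; length; tabulate)
open import Data.List.Membership.Propositional.Properties using (∈-filter⁺; ∈-allFin; ∈-length)
open import Data.Maybe.Base using (just; nothing)
open import Data.Nat.Base as ℕ using (ℕ; zero; suc; NonZero; _!; s≤s)
open import Data.Product.Base using (∃-syntax; _×_; _,_; proj₁; proj₂; swap)
open import Data.Sum.Base using (inj₁; inj₂; [_,_]′)
open import Data.Unit.Base using (tt)
open import Function.Base using (_∘_; id)
open import Level using (0ℓ) renaming (suc to lsuc)
open import Relation.Binary.Bundles using (Poset)
open import Relation.Binary.Definitions using (WeaklyDecidable)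
open import Relation.Binary.PropositionalEquality.Core as ≡ using (_≡_; _≢_)
open import Relation.Binary.Structures using (IsTotalOrder)
open import Relation.Nullary using (¬_; yes; no)
open import Relation.Nullary.Decidable using (decidable-stable)
open import Relation.Unary using (Pred; Decidable; U; ∅; ∁; ⋃; _∪_; _∩_; _⊆_; _≐_; _⊥_)

import Algebra.Properties.CommutativeSemiring.Exp as Exponentiation
import Algebra.Properties.Ring as RingProperties
import Algebra.Properties.Semiring.Mult as Multiples
import Algebra.Properties.Semiring.Mult.TCOptimised as Multiples′
import Algebra.Solver.Ring as RingSolver
import Data.Fin.Properties as Fin
import Data.Integer.Properties as ℤ
import Data.Nat.Properties as ℕ
import Relation.Binary.Reasoning.PartialOrder as ≤-Reasoning
import Relation.Binary.Reasoning.Setoid as ≈-Reasoning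

-- Ring solver with integer coefficients over a commutative ring.

module IntegerSolver (A : CommutativeRing 0ℓ 0ℓ) where
  open CommutativeRing A
  open Multiples′ semiring using (×-homo-+; ×1-homo-*) renaming (_×_ to _×′_; 1+× to ×′-suc)
  open RingProperties ring using (-‿distribˡ-*; -‿distribʳ-*; -‿+-comm; -‿involutive; -0#≈0#)
  open ≈-Reasoning setoid

  ⟦_⟧ℤ : ℤ → Carrier
  ⟦ + n ⟧ℤ      = n ×′ 1#
  ⟦ -[1+ n ] ⟧ℤ = - (suc n ×′ 1#)

  neg-homo : ∀ i → ⟦ ℤ.- i ⟧ℤ ≈ - ⟦ i ⟧ℤ
  neg-homo (+ zero)   = sym -0#≈0#
  neg-homo (+ suc n)  = refl
  neg-homo -[1+ n ]   = sym (-‿involutive _)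

  -- Induction strips one `suc` from both arguments; the inserted `1# - 1#` puts it back on the ring
  -- side. Sums of integers of mixed sign reduce to this case.
  ⊖-homo : ∀ m n → ⟦ m ⊖ n ⟧ℤ ≈ m ×′ 1# - n ×′ 1#
  ⊖-homo m zero = begin
    m ×′ 1#         ≈⟨ +-identityʳ _ ⟨
    m ×′ 1# + 0#    ≈⟨ +-congˡ -0#≈0# ⟨
    m ×′ 1# - 0#    ∎
  ⊖-homo zero (suc n) = sym (+-identityˡ _)
  ⊖-homo (suc m) (suc n) = begin
    ⟦ suc m ⊖ suc n ⟧ℤ                     ≡⟨ ≡.cong ⟦_⟧ℤ (ℤ.[1+m]⊖[1+n]≡m⊖n m n) ⟩
    ⟦ m ⊖ n ⟧ℤ                             ≈⟨ ⊖-homo m n ⟩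
    a - b                                  ≈⟨ +-congʳ (+-identityʳ a) ⟨
    a + 0# - b                             ≈⟨ +-congʳ (+-congˡ (-‿inverseʳ 1#)) ⟨
    a + (1# - 1#) - b                      ≈⟨ +-congʳ (+-assoc _ _ _) ⟨
    a + 1# - 1# - b                        ≈⟨ +-assoc _ _ _ ⟩
    a + 1# + (- 1# - b)                    ≈⟨ +-cong (+-comm _ _) (-‿+-comm _ _) ⟩
    1# + a - (1# + b)                      ≈⟨ +-cong (×′-suc m 1#) (-‿cong (×′-suc n 1#)) ⟨
    suc m ×′ 1# - suc n ×′ 1#              ∎
    where a = m ×′ 1#; b = n ×′ 1#

  +-homo : ∀ i j → ⟦ i ℤ.+ j ⟧ℤ ≈ ⟦ i ⟧ℤ + ⟦ j ⟧ℤ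
  +-homo (+ m)    (+ n)    = ×-homo-+ 1# m n
  +-homo (+ m)    -[1+ n ] = ⊖-homo m (suc n)
  +-homo -[1+ m ] (+ n)    = trans (⊖-homo n (suc m)) (+-comm _ _)
  +-homo -[1+ m ] -[1+ n ] = begin
    - (suc (suc (m ℕ.+ n)) ×′ 1#)
      ≡⟨ ≡.cong (λ k → - (k ×′ 1#)) (≡.cong suc (≡.sym (ℕ.+-suc m n))) ⟩
    - ((suc m ℕ.+ suc n) ×′ 1#)            ≈⟨ -‿cong (×-homo-+ 1# (suc m) (suc n)) ⟩
    - (suc m ×′ 1# + suc n ×′ 1#)          ≈⟨ -‿+-comm _ _ ⟨
    - (suc m ×′ 1#) - suc n ×′ 1#          ∎

  ⁺*⁺-homo : ∀ m n → ⟦ + m ℤ.* + n ⟧ℤ ≈ (m ×′ 1#) * (n ×′ 1#)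
  ⁺*⁺-homo m n = begin
    ⟦ + m ℤ.* + n ⟧ℤ                       ≡⟨ ≡.cong ⟦_⟧ℤ (ℤ.pos-* m n) ⟨
    (m ℕ.* n) ×′ 1#                        ≈⟨ ×1-homo-* m n ⟩
    (m ×′ 1#) * (n ×′ 1#)                  ∎

  ⁺*-homo : ∀ m j → ⟦ + m ℤ.* j ⟧ℤ ≈ (m ×′ 1#) * ⟦ j ⟧ℤ
  ⁺*-homo m (+ n)    = ⁺*⁺-homo m n
  ⁺*-homo m -[1+ n ] = begin
    ⟦ + m ℤ.* -[1+ n ] ⟧ℤ                  ≡⟨ ≡.cong ⟦_⟧ℤ (ℤ.neg-distribʳ-* (+ m) (+ suc n)) ⟨
    ⟦ ℤ.- (+ m ℤ.* + suc n) ⟧ℤ             ≈⟨ neg-homo (+ m ℤ.* + suc n) ⟩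
    - ⟦ + m ℤ.* + suc n ⟧ℤ                 ≈⟨ -‿cong (⁺*⁺-homo m (suc n)) ⟩
    - ((m ×′ 1#) * (suc n ×′ 1#))          ≈⟨ -‿distribʳ-* _ _ ⟩
    (m ×′ 1#) * - (suc n ×′ 1#)            ∎

  *-homo : ∀ i j → ⟦ i ℤ.* j ⟧ℤ ≈ ⟦ i ⟧ℤ * ⟦ j ⟧ℤ
  *-homo (+ m)    j = ⁺*-homo m j
  *-homo -[1+ m ] j = begin
    ⟦ -[1+ m ] ℤ.* j ⟧ℤ                    ≡⟨ ≡.cong ⟦_⟧ℤ (ℤ.neg-distribˡ-* (+ suc m) j) ⟨
    ⟦ ℤ.- (+ suc m ℤ.* j) ⟧ℤ               ≈⟨ neg-homo (+ suc m ℤ.* j) ⟩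
    - ⟦ + suc m ℤ.* j ⟧ℤ                   ≈⟨ -‿cong (⁺*-homo (suc m) j) ⟩
    - ((suc m ×′ 1#) * ⟦ j ⟧ℤ)             ≈⟨ -‿distribˡ-* _ _ ⟩
    - (suc m ×′ 1#) * ⟦ j ⟧ℤ               ∎

  homomorphism : ℤ.+-*-rawRing -Raw-AlmostCommutative⟶ fromCommutativeRing A
  homomorphism = record
    { ⟦_⟧    = ⟦_⟧ℤ
    ; +-homo = +-homo
    ; *-homo = *-homo
    ; -‿homo = neg-homo
    ; 0-homo = refl
    ; 1-homo = refl
    }

  -- Equal integers have equal images; distinct integers may still coincide in the ring, so the test
  -- is only weakly decidable.
  _coeff≟_ : WeaklyDecidable (Induced-equivalence homomorphism)
  i coeff≟ j with i ℤ.≟ j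
  ... | yes i≡j = just (reflexive (≡.cong ⟦_⟧ℤ i≡j))
  ... | no  _   = nothing

  open RingSolver ℤ.+-*-rawRing (fromCommutativeRing A) homomorphism _coeff≟_ public
    using (solve; con; _:+_; _:*_; _:-_; :-_; _:=_)

-- Ordered-field arithmetic, the Archimedean property and finite sums.

module RealProperties (em : ExcludedMiddle 0ℓ) (R : CompleteOrderedField) where
  open CompleteOrderedField R hiding (zero)
  open IsTotalOrder isTotalOrder public using (isPartialOrder) renaming
    (refl to ≤-refl; reflexive to ≤-reflexive; trans to ≤-trans; antisym to ≤-antisym; total to ≤-total)
  open IntegerSolver commutativeRing public using (solve; con; _:+_; _:*_; _:-_; :-_; _:=_)
  open Multiples semiring public using (×1-homo-*; ×-assoc-*; ×-assocˡ; ×-congʳ)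
  open Exponentiation commutativeSemiring public using (^-congˡ; ^-assocʳ; ^-distrib-*)
  open RingProperties ring using (-0#≈0#)

  ≤-poset : Poset 0ℓ 0ℓ 0ℓ
  ≤-poset = record { isPartialOrder = isPartialOrder }

  open ≤-Reasoning ≤-poset public

  x≤y⇒0≤y-x : ∀ {x y} → x ≤ y → 0# ≤ y - x
  x≤y⇒0≤y-x {x} {y} x≤y = begin
    0#    ≈⟨ -‿inverseʳ x ⟨
    x - x ≤⟨ +-monoˡ-≤ (- x) x≤y ⟩
    y - x ∎

  -- Certifies an inequality by an explicit nonnegative difference, which leaves an identity for the
  -- ring solver.
  ≤-from-gap : ∀ {x y e} → 0# ≤ e → y ≈ x + e → x ≤ y
  ≤-from-gap {x} {y} {e} 0≤e y≈x+e = begin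
    x      ≈⟨ +-identityˡ x ⟨
    0# + x ≤⟨ +-monoˡ-≤ x 0≤e ⟩
    e + x  ≈⟨ +-comm e x ⟩
    x + e  ≈⟨ y≈x+e ⟨
    y      ∎

  0≤y-x⇒x≤y : ∀ {x y} → 0# ≤ y - x → x ≤ y
  0≤y-x⇒x≤y {x} {y} p = ≤-from-gap p (solve 2 (λ x y → y := x :+ (y :- x)) refl x y)

  +-mono-≤ : ∀ {x y u v} → x ≤ y → u ≤ v → x + u ≤ y + v
  +-mono-≤ {x} {y} {u} {v} x≤y u≤v = begin
    x + u ≤⟨ +-monoˡ-≤ u x≤y ⟩
    y + u ≈⟨ +-comm y u ⟩
    u + y ≤⟨ +-monoˡ-≤ y u≤v ⟩
    v + y ≈⟨ +-comm v y ⟩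
    y + v ∎

  x≤x+y : ∀ {x y} → 0# ≤ y → x ≤ x + y
  x≤x+y 0≤y = ≤-from-gap 0≤y refl

  +-nonneg : ∀ {x y} → 0# ≤ x → 0# ≤ y → 0# ≤ x + y
  +-nonneg 0≤x 0≤y = ≤-trans 0≤x (x≤x+y 0≤y)

  +-cancelʳ-≤ : ∀ z {x y} → x + z ≤ y + z → x ≤ y
  +-cancelʳ-≤ z {x} {y} p = 0≤y-x⇒x≤y (≤-trans (x≤y⇒0≤y-x p)
    (≤-reflexive (solve 3 (λ x y z → (y :+ z) :- (x :+ z) := y :- x) refl x y z)))

  *-monoˡ-≤ : ∀ {x y z} → 0# ≤ z → x ≤ y → z * x ≤ z * y
  *-monoˡ-≤ {x} {y} {z} 0≤z x≤y = ≤-from-gap (*-nonneg 0≤z (x≤y⇒0≤y-x x≤y))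
    (solve 3 (λ x y z → z :* y := z :* x :+ z :* (y :- x)) refl x y z)

  *-mono-≤ : ∀ {x y u v} → 0# ≤ u → 0# ≤ y → x ≤ y → u ≤ v → x * u ≤ y * v
  *-mono-≤ {x} {y} {u} {v} 0≤u 0≤y x≤y u≤v = begin
    x * u ≈⟨ *-comm x u ⟩
    u * x ≤⟨ *-monoˡ-≤ 0≤u x≤y ⟩
    u * y ≈⟨ *-comm u y ⟩
    y * u ≤⟨ *-monoˡ-≤ 0≤y u≤v ⟩
    y * v ∎

  -- In the case `1# ≤ 0#` the element `0# - 1#` is nonnegative, and so is its square, which equals
  -- `1#`.
  0≤1 : 0# ≤ 1#
  0≤1 with ≤-total 0# 1#
  ... | inj₁ 0≤1 = 0≤1
  ... | inj₂ 1≤0 = ≤-trans (*-nonneg 0≤-1 0≤-1)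
    (≤-reflexive (solve 0 ((con (+ 0) :- con (+ 1)) :* (con (+ 0) :- con (+ 1)) := con (+ 1)) refl))
    where 0≤-1 = x≤y⇒0≤y-x 1≤0

  1≰0 : ¬ 1# ≤ 0#
  1≰0 1≤0 = 0≉1 (≤-antisym 0≤1 1≤0)

  0<1 : 0# < 1#
  0<1 = 0≤1 , 0≉1

  ≰⇒> : ∀ {x y} → ¬ x ≤ y → y < x
  ≰⇒> {x} {y} x≰y with ≤-total x y
  ... | inj₁ x≤y = ⊥-elim (x≰y x≤y)
  ... | inj₂ y≤x = y≤x , λ y≈x → x≰y (≤-reflexive (sym y≈x))

  <⇒≱ : ∀ {x y} → x < y → ¬ y ≤ x
  <⇒≱ (x≤y , x≉y) y≤x = x≉y (≤-antisym x≤y y≤x)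

  ≮0⇒≤0 : ∀ {x} → ¬ 0# < x → x ≤ 0#
  ≮0⇒≤0 {x} ≮ with ≤-total x 0#
  ... | inj₁ x≤0 = x≤0
  ... | inj₂ 0≤x with em {0# ≈ x}
  ...   | yes 0≈x = ≤-reflexive (sym 0≈x)
  ...   | no  0≉x = ⊥-elim (≮ (0≤x , 0≉x))

  x<y⇒0<y-x : ∀ {x y} → x < y → 0# < y - x
  x<y⇒0<y-x {x} {y} (x≤y , x≉y) = x≤y⇒0≤y-x x≤y , λ 0≈y-x → x≉y (≤-antisym x≤y
    (0≤y-x⇒x≤y (begin
      0#            ≈⟨ -0#≈0# ⟨
      - 0#          ≈⟨ -‿cong 0≈y-x ⟩
      - (y - x)     ≈⟨ solve 2 (λ x y → :- (y :- x) := x :- y) refl x y ⟩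
      x - y         ∎)))

  *-inverseˡ : ∀ {x} → 0# < x → x ⁻¹ * x ≈ 1#
  *-inverseˡ {x} (_ , 0≉x) = trans (*-comm (x ⁻¹) x) (*-inverseʳ (0≉x ∘ sym))

  *-inverse⁺ : ∀ {x} → 0# < x → x * x ⁻¹ ≈ 1#
  *-inverse⁺ (_ , 0≉x) = *-inverseʳ (0≉x ∘ sym)

  ⁻¹-nonneg : ∀ {x} → 0# < x → 0# ≤ x ⁻¹
  ⁻¹-nonneg {x} 0<x with ≤-total 0# (x ⁻¹)
  ... | inj₁ p = p
  ... | inj₂ p = ⊥-elim (1≰0 (begin
    1#       ≈⟨ *-inverse⁺ 0<x ⟨
    x * x ⁻¹ ≤⟨ *-monoˡ-≤ (proj₁ 0<x) p ⟩
    x * 0#   ≈⟨ zeroʳ x ⟩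
    0#       ∎))

  ⁻¹-pos : ∀ {x} → 0# < x → 0# < x ⁻¹
  ⁻¹-pos {x} 0<x = ⁻¹-nonneg 0<x , λ 0≈x⁻¹ → 0≉1 (begin-equality
    0#       ≈⟨ zeroʳ x ⟨
    x * 0#   ≈⟨ *-congˡ 0≈x⁻¹ ⟩
    x * x ⁻¹ ≈⟨ *-inverse⁺ 0<x ⟩
    1#       ∎)

  *-cancelˡ-≤ : ∀ {x y z} → 0# < z → z * x ≤ z * y → x ≤ y
  *-cancelˡ-≤ {x} {y} {z} 0<z p = begin
    x                ≈⟨ cancel x ⟨
    z ⁻¹ * (z * x)   ≤⟨ *-monoˡ-≤ (⁻¹-nonneg 0<z) p ⟩
    z ⁻¹ * (z * y)   ≈⟨ cancel y ⟩
    y                ∎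
    where
    cancel : ∀ v → z ⁻¹ * (z * v) ≈ v
    cancel v = trans (sym (*-assoc _ _ _)) (trans (*-congʳ (*-inverseˡ 0<z)) (*-identityˡ v))

  ⁻¹-unique : ∀ {x y} → x * y ≈ 1# → y ≈ x ⁻¹
  ⁻¹-unique {x} {y} xy≈1 = begin-equality
    y              ≈⟨ *-identityˡ y ⟨
    1# * y         ≈⟨ *-congʳ (*-inverseʳ x≉0) ⟨
    x * x ⁻¹ * y   ≈⟨ solve 3 (λ x i y → x :* i :* y := x :* y :* i) refl x (x ⁻¹) y ⟩
    x * y * x ⁻¹   ≈⟨ *-congʳ xy≈1 ⟩
    1# * x ⁻¹      ≈⟨ *-identityˡ _ ⟩
    x ⁻¹           ∎
    where
    x≉0 : ¬ x ≈ 0#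
    x≉0 x≈0 = 0≉1 (trans (sym (zeroˡ y)) (trans (*-congʳ (sym x≈0)) xy≈1))

  /-*-cancel : ∀ x {y} → 0# < y → x / y * y ≈ x
  /-*-cancel x {y} 0<y = trans (*-assoc x (y ⁻¹) y) (trans (*-congˡ (*-inverseˡ 0<y)) (*-identityʳ x))

  xy≤1⇒x≤y⁻¹ : ∀ {x y} → 0# < y → x * y ≤ 1# → x ≤ y ⁻¹
  xy≤1⇒x≤y⁻¹ {x} {y} 0<y xy≤1 = *-cancelˡ-≤ 0<y (begin
    y * x    ≈⟨ *-comm y x ⟩
    x * y    ≤⟨ xy≤1 ⟩
    1#       ≈⟨ *-inverse⁺ 0<y ⟨
    y * y ⁻¹ ∎)

  x≤y⁻¹⇒xy≤1 : ∀ {x y} → 0# < y → x ≤ y ⁻¹ → x * y ≤ 1#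
  x≤y⁻¹⇒xy≤1 {x} {y} 0<y p = begin
    x * y    ≈⟨ *-comm x y ⟩
    y * x    ≤⟨ *-monoˡ-≤ (proj₁ 0<y) p ⟩
    y * y ⁻¹ ≈⟨ *-inverse⁺ 0<y ⟩
    1#       ∎

  *-pos : ∀ {x y} → 0# < x → 0# < y → 0# < x * y
  *-pos {x} {y} 0<x 0<y = *-nonneg (proj₁ 0<x) (proj₁ 0<y) , λ 0≈xy → <⇒≱ 0<y (*-cancelˡ-≤ 0<x (begin
    x * y  ≈⟨ 0≈xy ⟨
    0#     ≈⟨ zeroʳ x ⟨
    x * 0# ∎))

  <-≤-trans : ∀ {x y z} → x < y → y ≤ z → x < z
  <-≤-trans x<y y≤z = ≰⇒> λ z≤x → <⇒≱ x<y (≤-trans y≤z z≤x)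

  ≤-<-trans : ∀ {x y z} → x ≤ y → y < z → x < z
  ≤-<-trans x≤y y<z = ≰⇒> λ z≤x → <⇒≱ y<z (≤-trans z≤x x≤y)

  ^-nonneg : ∀ {x} → 0# ≤ x → ∀ n → 0# ≤ x ^ n
  ^-nonneg 0≤x zero    = 0≤1
  ^-nonneg 0≤x (suc n) = *-nonneg 0≤x (^-nonneg 0≤x n)

  ^-pos : ∀ {x} → 0# < x → ∀ n → 0# < x ^ n
  ^-pos 0<x zero    = 0<1
  ^-pos 0<x (suc n) = *-pos 0<x (^-pos 0<x n)

  ^-monoˡ-≤ : ∀ {x y} → 0# ≤ x → x ≤ y → ∀ n → x ^ n ≤ y ^ n
  ^-monoˡ-≤ 0≤x x≤y zero    = ≤-refl
  ^-monoˡ-≤ 0≤x x≤y (suc n) = *-mono-≤ (^-nonneg 0≤x n) (≤-trans 0≤x x≤y) x≤y (^-monoˡ-≤ 0≤x x≤y n)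

  fromℕ-nonneg : ∀ n → 0# ≤ fromℕ n
  fromℕ-nonneg zero    = ≤-refl
  fromℕ-nonneg (suc n) = +-nonneg 0≤1 (fromℕ-nonneg n)

  1≤fromℕ : ∀ n .{{_ : NonZero n}} → 1# ≤ fromℕ n
  1≤fromℕ (suc n) = x≤x+y (fromℕ-nonneg n)

  fromℕ-pos : ∀ n .{{_ : NonZero n}} → 0# < fromℕ n
  fromℕ-pos n = <-≤-trans 0<1 (1≤fromℕ n)

  ·≈fromℕ* : ∀ n x → n · x ≈ fromℕ n * x
  ·≈fromℕ* n x = sym (trans (×-assoc-* n 1# x) (×-congʳ n (*-identityˡ x)))

  -- If no natural number exceeded `x`, the naturals would have a supremum `s`. Each `n` is
  -- `(n + 1) - 1`, hence at most `s - 1#`, so `s ≤ s - 1#`, which is absurd. The form `suc n` makes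
  -- the bound usable as a denominator.
  archimedean : ∀ x → ∃[ n ] x < fromℕ (suc n)
  archimedean x with em {∃[ n ] x < fromℕ (suc n)}
  ... | yes p = p
  ... | no ¬p = ⊥-elim (1≰0 (+-cancelʳ-≤ (s - 1#) (begin
    1# + (s - 1#)  ≈⟨ solve 2 (λ s o → o :+ (s :- o) := s) refl s 1# ⟩
    s              ≤⟨ sup-least Naturals (0# , zero , refl) (λ { (n , r≈n) → below-s-1 n r≈n }) ⟩
    s - 1#         ≈⟨ +-identityˡ _ ⟨
    0# + (s - 1#)  ∎)))
    where
    Naturals : ℝ → Set
    Naturals r = ∃[ n ] r ≈ fromℕ n
    s = sup Naturals
    fromℕ≤x : ∀ n → fromℕ n ≤ x
    fromℕ≤x n with ≤-total (fromℕ n) x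
    ... | inj₁ p = p
    ... | inj₂ x≤n with em {fromℕ n ≤ x}
    ...   | yes p = p
    ...   | no n≰x = ⊥-elim (¬p (n , <-≤-trans (≰⇒> n≰x) (≤-from-gap 0≤1 (+-comm 1# _))))
    below-s-1 : ∀ n {r} → r ≈ fromℕ n → r ≤ s - 1#
    below-s-1 n {r} r≈n = begin
      r                   ≈⟨ r≈n ⟩
      fromℕ n             ≈⟨ solve 2 (λ o m → m := o :+ m :- o) refl 1# (fromℕ n) ⟩
      fromℕ (suc n) - 1#  ≤⟨ +-monoˡ-≤ (- 1#)
        (sup-upper Naturals (λ { (m , r≈m) → ≤-trans (≤-reflexive r≈m) (fromℕ≤x m) }) (suc n , refl)) ⟩
      s - 1#              ∎

  -- If `x ≤ y` failed, half of the positive gap `x - y` would be a slack `ε` that violates the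
  -- hypothesis.
  ≤-from-slack : ∀ {x y} → (∀ ε → 0# < ε → x ≤ y + ε) → x ≤ y
  ≤-from-slack {x} {y} slack with em {x ≤ y}
  ... | yes x≤y = x≤y
  ... | no  x≰y = ⊥-elim (<⇒≱ 0<e (+-cancelʳ-≤ (y + e) (begin
      e + (y + e)            ≈⟨ solve 2 (λ y e → e :+ (y :+ e) := y :+ (e :+ e)) refl y e ⟩
      y + (e + e)            ≈⟨ +-congˡ e+e≈x-y ⟩
      y + (x - y)            ≈⟨ solve 2 (λ x y → y :+ (x :- y) := x) refl x y ⟩
      x                      ≤⟨ slack e 0<e ⟩
      y + e                  ≈⟨ +-identityˡ _ ⟨
      0# + (y + e)           ∎)))
    where
    2⁻¹ = fromℕ 2 ⁻¹
    e = (x - y) * 2⁻¹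
    0<e : 0# < e
    0<e = *-pos (x<y⇒0<y-x (≰⇒> x≰y)) (⁻¹-pos (fromℕ-pos 2))
    e+e≈x-y : e + e ≈ x - y
    e+e≈x-y = begin-equality
      e + e
        ≈⟨ solve 2 (λ d h → d :* h :+ d :* h := d :* ((con (+ 1) :+ (con (+ 1) :+ con (+ 0))) :* h))
          refl (x - y) 2⁻¹ ⟩
      (x - y) * (fromℕ 2 * 2⁻¹) ≈⟨ *-congˡ (*-inverse⁺ (fromℕ-pos 2)) ⟩
      (x - y) * 1#             ≈⟨ *-identityʳ _ ⟩
      x - y                    ∎

  ·-nonneg : ∀ {x} → 0# ≤ x → ∀ n → 0# ≤ n · x
  ·-nonneg 0≤x zero    = ≤-refl
  ·-nonneg 0≤x (suc n) = +-nonneg 0≤x (·-nonneg 0≤x n)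

  partialSum : (ℕ → ℝ) → ℕ → ℝ
  partialSum f n = sum {n} λ i → f (toℕ i)

  partialSum-nonneg : ∀ {f} → (∀ i → 0# ≤ f i) → ∀ n → 0# ≤ partialSum f n
  partialSum-nonneg 0≤f zero    = ≤-refl
  partialSum-nonneg 0≤f (suc n) = +-nonneg (0≤f 0) (partialSum-nonneg (0≤f ∘ suc) n)

  partialSum-cong : ∀ {f g} → (∀ i → f i ≈ g i) → ∀ n → partialSum f n ≈ partialSum g n
  partialSum-cong f≈g zero    = refl
  partialSum-cong f≈g (suc n) = +-cong (f≈g 0) (partialSum-cong (f≈g ∘ suc) n)

  partialSum-zero : ∀ {f} → (∀ i → f i ≈ 0#) → ∀ n → partialSum f n ≈ 0#
  partialSum-zero f≈0 zero    = refl
  partialSum-zero f≈0 (suc n) = trans (+-cong (f≈0 0) (partialSum-zero (f≈0 ∘ suc) n)) (+-identityˡ 0#)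

  partialSum-suc-≤ : ∀ {f} → (∀ i → 0# ≤ f i) → ∀ n → partialSum f n ≤ partialSum f (suc n)
  partialSum-suc-≤ {f} 0≤f zero    = +-nonneg (0≤f 0) ≤-refl
  partialSum-suc-≤ {f} 0≤f (suc n) = +-mono-≤ ≤-refl (partialSum-suc-≤ (0≤f ∘ suc) n)

  -- Summing `step` bounds the tail of `f` by the tail of `g` plus `u` times a sum of `f` with one
  -- term fewer; nonnegativity of `f` then allows equal lengths.
  partialSum-≤-shift : ∀ {f g u} → 0# ≤ u → (∀ i → 0# ≤ f i) → f 0 ≤ g 0 → (∀ i →
    f (suc i) ≤ g (suc i) + u * f i) →
                       ∀ n → partialSum f n ≤ partialSum g n + u * partialSum f n
  partialSum-≤-shift {u = u} 0≤u 0≤f f0≤g0 step zero = ≤-reflexive (sym (trans (+-identityˡ _) (zeroʳ u)))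
  partialSum-≤-shift {f} {g} {u} 0≤u 0≤f f0≤g0 step (suc n) = begin
    f 0 + partialSum (f ∘ suc) n
      ≤⟨ +-mono-≤ f0≤g0 (tails f (g ∘ suc) (f ∘ suc) step n) ⟩
    g 0 + (partialSum (g ∘ suc) n + u * partialSum f n)        ≈⟨ +-assoc _ _ _ ⟨
    partialSum g (suc n) + u * partialSum f n
      ≤⟨ +-mono-≤ ≤-refl (*-monoˡ-≤ 0≤u (partialSum-suc-≤ 0≤f n)) ⟩
    partialSum g (suc n) + u * partialSum f (suc n)            ∎
    where
    -- Stated for three unrelated sequences so that the induction can drop the head of each.
    tails : ∀ a b c → (∀ i → c i ≤ b i + u * a i) → ∀ n →
      partialSum c n ≤ partialSum b n + u * partialSum a n
    tails a b c p zero    = ≤-reflexive (sym (trans (+-identityˡ _) (zeroʳ u)))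
    tails a b c p (suc n) = ≤-trans (+-mono-≤ (p 0) (tails (a ∘ suc) (b ∘ suc) (c ∘ suc) (p ∘ suc) n))
      (≤-reflexive (solve 5 (λ a b A B u → (b :+ u :* a) :+ (B :+ u :* A) := (b :+ B) :+ u :* (a :+ A)) refl
        (a 0) (b 0) (partialSum (a ∘ suc) n) (partialSum (b ∘ suc) n) u))

-- Partial sums of the exponential series and the logarithm as a supremum.

module LogarithmProperties (em : ExcludedMiddle 0ℓ) (R : CompleteOrderedField) where
  open CompleteOrderedField R hiding (zero)
  open RealProperties em R

  expTerm : ℝ → ℕ → ℝ
  expTerm x i = x ^ i / fromℕ (i !)

  expSum : ℕ → ℝ → ℝ
  expSum n x = partialSum (expTerm x) n

  !-pos : ∀ i → 0# < fromℕ (i !)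
  !-pos i = fromℕ-pos (i !) {{i ℕ.!≢0}}

  expTerm-nonneg : ∀ {x} → 0# ≤ x → ∀ i → 0# ≤ expTerm x i
  expTerm-nonneg 0≤x i = *-nonneg (^-nonneg 0≤x i) (⁻¹-nonneg (!-pos i))

  expSum-nonneg : ∀ {x} → 0# ≤ x → ∀ n → 0# ≤ expSum n x
  expSum-nonneg 0≤x = partialSum-nonneg (expTerm-nonneg 0≤x)

  expSum-cong : ∀ n {x y} → x ≈ y → expSum n x ≈ expSum n y
  expSum-cong n x≈y = partialSum-cong (λ i → *-congʳ {fromℕ (i !) ⁻¹} (^-congˡ i x≈y)) n

  [1+i]/[1+i]!≈1/i! : ∀ i → fromℕ (suc i) * fromℕ (suc i !) ⁻¹ ≈ fromℕ (i !) ⁻¹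
  [1+i]/[1+i]!≈1/i! i = ⁻¹-unique (begin-equality
    fromℕ (i !) * (fromℕ (suc i) * r)
      ≈⟨ solve 3 (λ a b r → a :* (b :* r) := b :* a :* r) refl (fromℕ (i !)) (fromℕ (suc i)) r ⟩
    fromℕ (suc i) * fromℕ (i !) * r       ≈⟨ *-congʳ (×1-homo-* (suc i) (i !)) ⟨
    fromℕ (suc i !) * r                   ≈⟨ *-inverse⁺ (!-pos (suc i)) ⟩
    1#                                    ∎)
    where r = fromℕ (suc i !) ⁻¹

  -- The mean value inequality bⁿ − aⁿ ≤ n (b − a) bⁿ⁻¹ for b = a + u.
  [a+u]^[1+i]≤ : ∀ {a u} → 0# ≤ a → 0# ≤ u → ∀ i →
    (a + u) ^ suc i ≤ a ^ suc i + fromℕ (suc i) * (u * (a + u) ^ i)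
  [a+u]^[1+i]≤ {a} {u} 0≤a 0≤u zero = ≤-reflexive
    (solve 2 (λ a u → (a :+ u) :* con (+ 1) := a :* con (+ 1) :+ (con (+ 1) :+ con (+ 0)) :* (u :* con (+ 1))) refl a u)
  [a+u]^[1+i]≤ {a} {u} 0≤a 0≤u (suc i) = ≤-from-gap
    (+-nonneg (*-nonneg (+-nonneg 0≤a 0≤u) (x≤y⇒0≤y-x ([a+u]^[1+i]≤ 0≤a 0≤u i)))
              (*-nonneg 0≤u (x≤y⇒0≤y-x (^-monoˡ-≤ 0≤a (x≤x+y 0≤u) (suc i)))))
    (solve 5 (λ a u A C f → a :* A :+ (con (+ 1) :+ f) :* (u :* ((a :+ u) :* C)) :=
        (a :+ u) :* ((a :+ u) :* C) :+
        ((a :+ u) :* ((A :+ f :* (u :* C)) :- (a :+ u) :* C) :+ u :* ((a :+ u) :* C :- A)))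
      refl a u (a ^ suc i) ((a + u) ^ i) (fromℕ (suc i)))

  -- The mean value inequality divided by `(1 + i)!`, where the factor `1 + i` turns `1 / (1 + i)!`
  -- into `1 / i!`.
  expTerm-shift : ∀ {a u} → 0# ≤ a → 0# ≤ u → ∀ i →
    expTerm (a + u) (suc i) ≤ expTerm a (suc i) + u * expTerm (a + u) i
  expTerm-shift {a} {u} 0≤a 0≤u i = begin
    (a + u) ^ suc i * r                                         ≈⟨ *-comm _ r ⟩
    r * (a + u) ^ suc i
      ≤⟨ *-monoˡ-≤ (⁻¹-nonneg (!-pos (suc i))) ([a+u]^[1+i]≤ 0≤a 0≤u i) ⟩
    r * (a ^ suc i + fromℕ (suc i) * (u * (a + u) ^ i))
      ≈⟨ solve 5 (λ r A f u C → r :* (A :+ f :* (u :* C)) := A :* r :+ u :* (C :* (f :* r)))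
        refl r (a ^ suc i) (fromℕ (suc i)) u ((a + u) ^ i) ⟩
    a ^ suc i * r + u * ((a + u) ^ i * (fromℕ (suc i) * r))
      ≈⟨ +-congˡ (*-congˡ (*-congˡ ([1+i]/[1+i]!≈1/i! i))) ⟩
    expTerm a (suc i) + u * expTerm (a + u) i                   ∎
    where r = fromℕ (suc i !) ⁻¹

  expSum-shift : ∀ {a u} → 0# ≤ a → 0# ≤ u → ∀ m → expSum m (a + u) * (1# - u) ≤ expSum m a
  expSum-shift {a} {u} 0≤a 0≤u m = 0≤y-x⇒x≤y (begin
    0#
      ≤⟨ x≤y⇒0≤y-x (partialSum-≤-shift {g = expTerm a} 0≤u (expTerm-nonneg (+-nonneg 0≤a 0≤u)) ≤-refl (expTerm-shift 0≤a 0≤u) m) ⟩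
    expSum m a + u * expSum m (a + u) - expSum m (a + u)
      ≈⟨ solve 3 (λ A B u → A :+ u :* B :- B := A :- B :* (con (+ 1) :- u))
        refl (expSum m a) (expSum m (a + u)) u ⟩
    expSum m a - expSum m (a + u) * (1# - u)   ∎)

  -- Only the term `i = 0` survives, since `0# ^ 0` is `1#`. The empty sum at `m = 0` makes this an
  -- inequality.
  expSum-0≤1 : ∀ m → expSum m 0# ≤ 1#
  expSum-0≤1 zero    = 0≤1
  expSum-0≤1 (suc m) = ≤-reflexive (begin-equality
    1# * (1# + 0#) ⁻¹ + partialSum (expTerm 0# ∘ suc) m
      ≈⟨ +-cong (*-congˡ (sym (⁻¹-unique
        (solve 0 ((con (+ 1) :+ con (+ 0)) :* con (+ 1) := con (+ 1)) refl))))
                                                                  (partialSum-zero (λ i → trans (*-congʳ (zeroˡ (0# ^ i))) (zeroˡ (fromℕ (suc i !) ⁻¹))) m) ⟩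
    1# * 1# + 0#
      ≈⟨ solve 0 (con (+ 1) :* con (+ 1) :+ con (+ 0) := con (+ 1)) refl ⟩
    1#                                                   ∎)

  -- Each use of `expSum-shift` removes one `u` from the argument and one factor `1# - u`, down to
  -- `expSum m 0#`.
  expSum-≤ : ∀ {u} → 0# ≤ u → u ≤ 1# → ∀ m n → expSum m (n · u) * (1# - u) ^ n ≤ 1#
  expSum-≤ {u} 0≤u u≤1 m zero = ≤-trans (≤-reflexive (*-identityʳ _)) (expSum-0≤1 m)
  expSum-≤ {u} 0≤u u≤1 m (suc n) = begin
    expSum m (u + n · u) * ((1# - u) * (1# - u) ^ n)    ≈⟨ *-congʳ (expSum-cong m (+-comm _ _)) ⟩
    expSum m (n · u + u) * ((1# - u) * (1# - u) ^ n)    ≈⟨ *-assoc _ _ _ ⟨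
    expSum m (n · u + u) * (1# - u) * (1# - u) ^ n
      ≤⟨ *-mono-≤ (^-nonneg (x≤y⇒0≤y-x u≤1) n) (expSum-nonneg (·-nonneg 0≤u n) m) (expSum-shift (·-nonneg 0≤u n) 0≤u m) ≤-refl ⟩
    expSum m (n · u) * (1# - u) ^ n                     ≤⟨ expSum-≤ 0≤u u≤1 m n ⟩
    1#                                                  ∎

  -- `exp x` is the supremum of the eventual lower bounds of the partial sums. Each such bound lies
  -- below some partial sum, and `0#` is one of them.
  exp-≤ : ∀ {x b} → 0# ≤ x → (∀ n → expSum n x ≤ b) → exp x ≤ b
  exp-≤ 0≤x p = sup-least _ (0# , 0 , λ n _ → expSum-nonneg 0≤x n) (λ { (m , q) → ≤-trans (q m ℕ.≤-refl) (p m) })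

  -- Cutting `x` into `suc n > x` equal pieces `u < 1#` makes `(1# - u) ^ suc n` positive, so
  -- `expSum-≤` can be divided by it.
  expSum-bounded : ∀ {x} → 0# ≤ x → ∃[ b ] ∀ m → expSum m x ≤ b
  expSum-bounded {x} 0≤x with archimedean x
  ... | n , x<1+n = ((1# - u) ^ suc n) ⁻¹ , λ m → xy≤1⇒x≤y⁻¹ (^-pos (x<y⇒0<y-x u<1) (suc n)) (begin
      expSum m x * (1# - u) ^ suc n             ≈⟨ *-congʳ (expSum-cong m x≈[1+n]u) ⟩
      expSum m (suc n · u) * (1# - u) ^ suc n   ≤⟨ expSum-≤ 0≤u (proj₁ u<1) m (suc n) ⟩
      1#                                        ∎)
    where
    u = x / fromℕ (suc n)
    0<1+n = fromℕ-pos (suc n)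
    0≤u : 0# ≤ u
    0≤u = *-nonneg 0≤x (⁻¹-nonneg 0<1+n)
    [1+n]u≈x : fromℕ (suc n) * u ≈ x
    [1+n]u≈x = trans (solve 3 (λ n x i → n :* (x :* i) := x :* (n :* i))
      refl _ x _) (trans (*-congˡ (*-inverse⁺ 0<1+n)) (*-identityʳ x))
    x≈[1+n]u : x ≈ suc n · u
    x≈[1+n]u = sym (trans (·≈fromℕ* (suc n) u) [1+n]u≈x)
    u<1 : u < 1#
    u<1 = ≰⇒> λ 1≤u → <⇒≱ x<1+n (begin
      fromℕ (suc n)       ≈⟨ *-identityʳ _ ⟨
      fromℕ (suc n) * 1#  ≤⟨ *-monoˡ-≤ (proj₁ 0<1+n) 1≤u ⟩
      fromℕ (suc n) * u   ≈⟨ [1+n]u≈x ⟩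
      x                   ∎)

  -- `x` is the term of index 1, so it is a lower bound for all partial sums with at least two
  -- terms. Boundedness of the partial sums is what makes the supremum an upper bound.
  x≤exp[x] : ∀ {x} → 0# ≤ x → x ≤ exp x
  x≤exp[x] {x} 0≤x = sup-upper _ (λ { (m , q) → ≤-trans (q m ℕ.≤-refl) (proj₂ (expSum-bounded 0≤x) m) })
    (2 , λ { (suc (suc n)) (s≤s (s≤s _)) → begin
      x                                          ≈⟨ x≈expTerm1 ⟩
      expTerm x 1
        ≤⟨ x≤x+y (partialSum-nonneg (λ i → expTerm-nonneg 0≤x (suc (suc i))) n) ⟩
      partialSum (expTerm x ∘ suc) (suc n)       ≤⟨ x≤x+y (expTerm-nonneg 0≤x 0) ⟩
      partialSum (expTerm x ∘ suc) (suc n) + expTerm x 0  ≈⟨ +-comm _ _ ⟩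
      expSum (suc (suc n)) x                     ∎ })
    where
    x≈expTerm1 : x ≈ x * 1# * (1# + 0#) ⁻¹
    x≈expTerm1 = trans (solve 1 (λ x → x := x :* con (+ 1) :* con (+ 1)) refl x)
      (*-congˡ (⁻¹-unique (solve 0 ((con (+ 1) :+ con (+ 0)) :* con (+ 1) := con (+ 1)) refl)))

  -- The supremum defining `log x` is an upper bound once its set is bounded, and `x` itself bounds
  -- it because `y ≤ exp y` for nonnegative `y`.
  exp[y]≤x⇒y≤log[x] : ∀ {x y} → 0# ≤ x → exp y ≤ x → y ≤ log x
  exp[y]≤x⇒y≤log[x] {x} 0≤x = sup-upper _ bound
    where
    bound : ∀ {y} → exp y ≤ x → y ≤ x
    bound {y} p with ≤-total 0# y
    ... | inj₁ 0≤y = ≤-trans (x≤exp[x] 0≤y) p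
    ... | inj₂ y≤0 = ≤-trans y≤0 0≤x

  log-nonneg : ∀ {x} → 1# ≤ x → 0# ≤ log x
  log-nonneg 1≤x = exp[y]≤x⇒y≤log[x] (≤-trans 0≤1 1≤x) (≤-trans (exp-≤ ≤-refl expSum-0≤1) 1≤x)

  -- Replaces the limit `d → 0`: if `a` exceeded `1#`, the choice `d = (a - 1) / (1 + a)` would give
  -- `a * (1# - d) ≈ 1# + d`.
  ≤1-from-factor : ∀ {a} → 0# ≤ a → (∀ d → 0# < d → d < 1# → a * (1# - d) ≤ 1#) → a ≤ 1#
  ≤1-from-factor {a} 0≤a p with em {a ≤ 1#}
  ... | yes a≤1 = a≤1
  ... | no  a≰1 = ⊥-elim (<⇒≱ 0<d (≤-from-gap (x≤y⇒0≤y-x (p d 0<d d<1)) (begin-equality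
      0#                            ≈⟨ -‿inverseʳ e ⟨
      e - e                         ≈⟨ +-congʳ (/-*-cancel e 0<1+a) ⟨
      d * (1# + a) - (a - 1#)
        ≈⟨ solve 2 (λ a d → d :* (con (+ 1) :+ a) :- (a :- con (+ 1)) := d :+ (con (+ 1) :- a :* (con (+ 1) :- d))) refl a d ⟩
      d + (1# - a * (1# - d))       ∎)))
    where
    e = a - 1#
    d = e / (1# + a)
    0<1+a : 0# < 1# + a
    0<1+a = <-≤-trans 0<1 (x≤x+y 0≤a)
    0<d : 0# < d
    0<d = *-pos (x<y⇒0<y-x (≰⇒> a≰1)) (⁻¹-pos 0<1+a)
    d<1 : d < 1#
    d<1 = ≰⇒> λ 1≤d → 1≰0 (+-cancelʳ-≤ a (begin
      1# + a           ≈⟨ *-identityʳ _ ⟨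
      (1# + a) * 1#    ≤⟨ *-monoˡ-≤ (proj₁ 0<1+a) 1≤d ⟩
      (1# + a) * d     ≈⟨ *-comm _ d ⟩
      d * (1# + a)     ≈⟨ /-*-cancel e 0<1+a ⟩
      a - 1#
        ≤⟨ ≤-from-gap 0≤1 (solve 1 (λ a → con (+ 0) :+ a := a :- con (+ 1) :+ con (+ 1)) refl a) ⟩
      0# + a           ∎))

  x[1-log[x]/n]^n≤1 : ∀ {x u} n → 1# ≤ x → 0# ≤ u → u < 1# → log x ≈ n · u → x * (1# - u) ^ n ≤ 1#
  x[1-log[x]/n]^n≤1 {x} {u} n 1≤x 0≤u u<1 log[x]≈nu = ≤1-from-factor (*-nonneg 0≤x (proj₁ 0<v)) step
    where
    0≤x = ≤-trans 0≤1 1≤x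
    v = (1# - u) ^ n
    0<v = ^-pos (x<y⇒0<y-x u<1) n
    module _ (d : ℝ) (0<d : 0# < d) (d<1 : d < 1#) where
      -- Moving beyond the supremum `log x` by `d` forces `x < exp y`, while the partial sums at `y`
      -- stay below `((1# - d) * v) ⁻¹`.
      y = log x + d
      0<w = *-pos (x<y⇒0<y-x d<1) 0<v
      0≤log = log-nonneg 1≤x
      expSum-bound : ∀ m → expSum m y ≤ ((1# - d) * v) ⁻¹
      expSum-bound m = xy≤1⇒x≤y⁻¹ 0<w (begin
        expSum m y * ((1# - d) * v)       ≈⟨ *-assoc _ _ _ ⟨
        expSum m y * (1# - d) * v
          ≤⟨ *-mono-≤ (proj₁ 0<v) (expSum-nonneg 0≤log m) (expSum-shift 0≤log (proj₁ 0<d) m) ≤-refl ⟩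
        expSum m (log x) * v              ≈⟨ *-congʳ (expSum-cong m log[x]≈nu) ⟩
        expSum m (n · u) * v              ≤⟨ expSum-≤ 0≤u (proj₁ u<1) m n ⟩
        1#                                ∎)
      x<exp[y] : x < exp y
      x<exp[y] = ≰⇒> λ p → <⇒≱ 0<d (+-cancelʳ-≤ (log x) (begin
        d + log x      ≈⟨ +-comm d _ ⟩
        y              ≤⟨ exp[y]≤x⇒y≤log[x] 0≤x p ⟩
        log x          ≈⟨ +-identityˡ _ ⟨
        0# + log x     ∎))
      step : x * v * (1# - d) ≤ 1#
      step = begin
        x * v * (1# - d)
          ≈⟨ solve 3 (λ x v w → x :* v :* w := x :* (w :* v)) refl x v (1# - d) ⟩
        x * ((1# - d) * v)
          ≤⟨ x≤y⁻¹⇒xy≤1 0<w (≤-trans (proj₁ x<exp[y]) (exp-≤ (+-nonneg 0≤log (proj₁ 0<d)) expSum-bound)) ⟩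
        1#                    ∎

  -- The gap is `u²(3 - u)`, with `3 - u` written as `1 + 1 + (1 - u)` to show that it is
  -- nonnegative.
  1-3u≤[1-u]^3 : ∀ {u} → 0# ≤ u → u ≤ 1# → 1# - fromℕ 3 * u ≤ (1# - u) ^ 3
  1-3u≤[1-u]^3 {u} 0≤u u≤1 = ≤-from-gap
    (*-nonneg (*-nonneg 0≤u 0≤u) (+-nonneg (+-nonneg 0≤1 0≤1) (x≤y⇒0≤y-x u≤1)))
    (solve 1 (λ u → let o = con (+ 1) in
      (o :- u) :* ((o :- u) :* ((o :- u) :* o)) :=
      o :- (o :+ (o :+ (o :+ con (+ 0)))) :* u :+ u :* u :* (o :+ o :+ (o :- u))) refl u)

  -- Bernoulli replaces `1 - 3u` by `(1 - u)³`; exchanging the exponents 3 and `n` leaves the cube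
  -- of the bound for `x * (1# - u) ^ n`.
  x^3[1-3u]^n≤1 : ∀ {x u} n → 1# ≤ x → 0# ≤ u → fromℕ 3 * u < 1# → log x ≈ n · u →
                  x ^ 3 * (1# - fromℕ 3 * u) ^ n ≤ 1#
  x^3[1-3u]^n≤1 {x} {u} n 1≤x 0≤u 3u<1 log[x]≈nu = begin
    x ^ 3 * (1# - fromℕ 3 * u) ^ n
      ≤⟨ *-monoˡ-≤ (^-nonneg 0≤x 3) (^-monoˡ-≤ (x≤y⇒0≤y-x (proj₁ 3u<1)) (1-3u≤[1-u]^3 0≤u (proj₁ u<1)) n) ⟩
    x ^ 3 * ((1# - u) ^ 3) ^ n      ≈⟨ *-congˡ (^-assocʳ (1# - u) 3 n) ⟩
    x ^ 3 * (1# - u) ^ (3 ℕ.* n)    ≡⟨ ≡.cong (λ k → x ^ 3 * (1# - u) ^ k) (ℕ.*-comm 3 n) ⟩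
    x ^ 3 * (1# - u) ^ (n ℕ.* 3)    ≈⟨ *-congˡ (^-assocʳ (1# - u) n 3) ⟨
    x ^ 3 * ((1# - u) ^ n) ^ 3      ≈⟨ ^-distrib-* x ((1# - u) ^ n) 3 ⟨
    (x * (1# - u) ^ n) ^ 3
      ≤⟨ ^-monoˡ-≤ (*-nonneg 0≤x (^-nonneg (proj₁ (x<y⇒0<y-x u<1)) n)) (x[1-log[x]/n]^n≤1 n 1≤x 0≤u u<1 log[x]≈nu) 3 ⟩
    1# ^ 3
      ≈⟨ solve 0 (let o = con (+ 1) in o :* (o :* (o :* o)) := o) refl ⟩
    1#                              ∎
    where
    0≤x = ≤-trans 0≤1 1≤x
    u<1 : u < 1#
    u<1 = ≤-<-trans (≤-from-gap (+-nonneg 0≤u 0≤u)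
      (solve 1 (λ u → let o = con (+ 1) in (o :+ (o :+ (o :+ con (+ 0)))) :* u := u :+ (u :+ u))
        refl u)) 3u<1

  -- 1 − p is a probability only for p ≤ 1, hence the truncation of the threshold at 1.
  truncated-threshold : ∀ {x} n .{{_ : NonZero n}} → 1# ≤ x → let p = (fromℕ 3 * log x) / fromℕ n in
    ∃[ r ] 0# ≤ r × r ≤ p × r ≤ 1# × (1# - r) ^ n ≤ (x ⁻¹) ^ 3
  truncated-threshold {x} n 1≤x with em {1# ≤ (fromℕ 3 * log x) / fromℕ n}
  ... | yes 1≤p = 1# , 0≤1 , 1≤p , ≤-refl , ≤-trans (≤-reflexive (0^n n)) (^-nonneg (⁻¹-nonneg (<-≤-trans 0<1 1≤x)) 3)
    where
    0^n : ∀ n .{{_ : NonZero n}} → (1# - 1#) ^ n ≈ 0#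
    0^n (suc n) = trans (*-congʳ (-‿inverseʳ 1#)) (zeroˡ _)
  ... | no 1≰p = p , *-nonneg (*-nonneg (fromℕ-nonneg 3) 0≤log) 0≤n⁻¹ , ≤-refl , proj₁ p<1 ,
      *-cancelˡ-≤ (^-pos 0<x 3) (begin
        x ^ 3 * (1# - p) ^ n                  ≈⟨ *-congˡ (^-congˡ n (+-congˡ (-‿cong p≈3u))) ⟩
        x ^ 3 * (1# - fromℕ 3 * u) ^ n
          ≤⟨ x^3[1-3u]^n≤1 n 1≤x (*-nonneg 0≤log 0≤n⁻¹) (≤-<-trans (≤-reflexive (sym p≈3u)) p<1) log[x]≈nu ⟩
        1#
          ≈⟨ solve 0 (let o = con (+ 1) in o := o :* (o :* (o :* o))) refl ⟩
        1# ^ 3                                ≈⟨ ^-congˡ 3 (*-inverse⁺ 0<x) ⟨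
        (x * x ⁻¹) ^ 3                        ≈⟨ ^-distrib-* x (x ⁻¹) 3 ⟩
        x ^ 3 * (x ⁻¹) ^ 3                    ∎)
    where
    p = (fromℕ 3 * log x) / fromℕ n
    u = log x / fromℕ n
    0<x = <-≤-trans 0<1 1≤x
    0≤log = log-nonneg 1≤x
    0≤n⁻¹ = ⁻¹-nonneg (fromℕ-pos n)
    p<1 : p < 1#
    p<1 = ≰⇒> 1≰p
    p≈3u : p ≈ fromℕ 3 * u
    p≈3u = *-assoc _ _ _
    log[x]≈nu : log x ≈ n · u
    log[x]≈nu = sym (trans (·≈fromℕ* n u) (trans (*-comm _ u) (/-*-cancel (log x) (fromℕ-pos n))))

-- Closure of σ-algebras under finite operations.

module σAlgebraProperties (em : ExcludedMiddle 0ℓ) {X : Set} {E : Pred (Pred X 0ℓ) (lsuc 0ℓ)} (isσ : IsσAlgebra E) where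
  open IsσAlgebra isσ public renaming (resp to ≐-closed; univ to U-closed; compl to ∁-closed; union to ⋃-closed)

  ∅-closed : E ∅
  ∅-closed = ≐-closed ((λ ¬⊤ → ¬⊤ tt) , λ ()) (∁-closed U-closed)

  -- Padding with `∅` reduces binary unions to countable ones and keeps the sequence pairwise
  -- disjoint when `A` and `B` are.
  pairSeq : Pred X 0ℓ → Pred X 0ℓ → ℕ → Pred X 0ℓ
  pairSeq A B zero          = A
  pairSeq A B (suc zero)    = B
  pairSeq A B (suc (suc _)) = ∅

  ⋃-pairSeq : ∀ {A B} → ⋃ ℕ (pairSeq A B) ≐ A ∪ B
  ⋃-pairSeq = (λ { (zero , a) → inj₁ a ; (suc zero , b) → inj₂ b }) , [ (0 ,_) , (1 ,_) ]′

  pairSeq-closed : ∀ {A B} → E A → E B → ∀ n → E (pairSeq A B n)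
  pairSeq-closed a b zero          = a
  pairSeq-closed a b (suc zero)    = b
  pairSeq-closed a b (suc (suc _)) = ∅-closed

  ∪-closed : ∀ {A B} → E A → E B → E (A ∪ B)
  ∪-closed a b = ≐-closed ⋃-pairSeq (⋃-closed (pairSeq-closed a b))

  -- De Morgan; excluded middle removes the double negations.
  ∩-closed : ∀ {A B} → E A → E B → E (A ∩ B)
  ∩-closed a b = ≐-closed
    ((λ p → decidable-stable em (p ∘ inj₁) , decidable-stable em (p ∘ inj₂)) ,
     λ { (x∈A , x∈B) → [ (λ x∉A → x∉A x∈A) , (λ x∉B → x∉B x∈B) ]′ })
    (∁-closed (∪-closed (∁-closed a) (∁-closed b)))

  ∃-closed : ∀ {n} {A : Fin n → Pred X 0ℓ} → (∀ i → E (A i)) → E (λ x → ∃[ i ] A i x)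
  ∃-closed {zero}  e = ≐-closed ((λ ()) , λ ()) ∅-closed
  ∃-closed {suc n} e = ≐-closed
    ([ (zero ,_) , (λ { (i , p) → suc i , p }) ]′ , λ { (zero , p) → inj₁ p ; (suc i , p) → inj₂ (i , p) })
    (∪-closed (e zero) (∃-closed (e ∘ suc)))

  ∀-closed : ∀ {n} {A : Fin n → Pred X 0ℓ} → (∀ i → E (A i)) → E (λ x → ∀ i → A i x)
  ∀-closed {zero}  e = ≐-closed ((λ _ ()) , λ _ → tt) U-closed
  ∀-closed {suc n} e = ≐-closed
    ((λ { (p , q) → λ { zero → p ; (suc i) → q i } }) , λ p → p zero , p ∘ suc)
    (∩-closed (e zero) (∀-closed (e ∘ suc)))

  -- Used for the condition that a word occurs in some document, which does not depend on the
  -- outcome.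
  const-closed : ∀ (Q : Set) → E (λ _ → Q)
  const-closed Q with em {Q}
  ... | yes q = ≐-closed ((λ _ → q) , λ _ → tt) U-closed
  ... | no ¬q = ≐-closed ((λ ()) , ¬q) ∅-closed

-- Borel sets of reals.

module BorelProperties (em : ExcludedMiddle 0ℓ) (R : CompleteOrderedField) where
  open CompleteOrderedField R hiding (zero)
  open RealProperties em R

  Borel-isσAlgebra : IsσAlgebra (Borel R)
  Borel-isσAlgebra = record { resp = resp ; univ = univ ; compl = compl ; union = union }

  open σAlgebraProperties em Borel-isσAlgebra public using () renaming (∩-closed to ∩-Borel)

  -- The generators are closed lower rays, so the negative reals are written as the union of the
  -- rays up to `-1/(n + 1)`; the Archimedean property shows that every negative real is covered.
  nonneg-Borel : Borel R (0# ≤_)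
  nonneg-Borel = resp (to , from) (compl (union λ n → ray (- (fromℕ (suc n) ⁻¹))))
    where
    to : ∀ {x} → ¬ (∃[ n ] x ≤ - (fromℕ (suc n) ⁻¹)) → 0# ≤ x
    to {x} p with em {0# ≤ x}
    ... | yes 0≤x = 0≤x
    ... | no  0≰x with archimedean ((0# - x) ⁻¹)
    ...   | n , y⁻¹<N = ⊥-elim (p (n , ≤-from-gap (x≤y⇒0≤y-x N⁻¹≤y)
          (solve 2 (λ x i → :- i := x :+ (con (+ 0) :- x :- i)) refl x (N ⁻¹))))
      where
      N = fromℕ (suc n)
      y = 0# - x
      0<y = x<y⇒0<y-x (≰⇒> 0≰x)
      N⁻¹≤y : N ⁻¹ ≤ y
      N⁻¹≤y = *-cancelˡ-≤ (fromℕ-pos (suc n)) (begin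
        N * N ⁻¹   ≈⟨ *-inverse⁺ (fromℕ-pos (suc n)) ⟩
        1#         ≈⟨ *-inverse⁺ 0<y ⟨
        y * y ⁻¹   ≤⟨ *-monoˡ-≤ (proj₁ 0<y) (proj₁ y⁻¹<N) ⟩
        y * N      ≈⟨ *-comm y N ⟩
        N * y      ∎)
    from : ∀ {x} → 0# ≤ x → ¬ (∃[ n ] x ≤ - (fromℕ (suc n) ⁻¹))
    from {x} 0≤x (n , x≤-N⁻¹) = <⇒≱ (⁻¹-pos (fromℕ-pos (suc n)))
      (≤-from-gap (≤-trans 0≤x x≤-N⁻¹) (sym (-‿inverseʳ _)))

-- Finite additivity, the union bound and tails of uniform variables.

module ProbabilityProperties (em : ExcludedMiddle 0ℓ) (R : CompleteOrderedField) (𝓟 : ProbabilitySpace R) where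
  open CompleteOrderedField R hiding (zero)
  open ProbabilitySpace 𝓟
  open RealProperties em R
  open BorelProperties em R
  open σAlgebraProperties em isσAlgebra public

  ⟶-eventually-const : ∀ {a l s} k → (∀ n → a (k ℕ.+ n) ≈ s) → a ⟶ l → s ≈ l
  ⟶-eventually-const {a} {l} {s} k a≈s a⟶l = ≤-antisym
    (≤-from-slack λ ε 0<ε → let m , p = a⟶l ε 0<ε in begin
      s               ≈⟨ a≈s m ⟨
      a (k ℕ.+ m)     ≤⟨ proj₂ (p (k ℕ.+ m) (ℕ.m≤n+m m k)) ⟩
      l + ε           ∎)
    (≤-from-slack λ ε 0<ε → let m , p = a⟶l ε 0<ε in begin
      l               ≈⟨ solve 2 (λ l e → l := l :- e :+ e) refl l ε ⟩
      l - ε + ε       ≤⟨ +-monoˡ-≤ ε (proj₁ (p (k ℕ.+ m) (ℕ.m≤n+m m k))) ⟩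
      a (k ℕ.+ m) + ε ≈⟨ +-congʳ (a≈s m) ⟩
      s + ε           ∎)

  -- For the constant sequence `∅`, partial sums of `c = P ∅` converge to `c`. If `c` were positive,
  -- tolerance `c` would cap late sums at `c + c`, but sums of `3 + m` terms reach at least
  -- `c + (c + c)`.
  P-∅ : P ∅ ≈ 0#
  P-∅ = ≤-antisym (≮0⇒≤0 λ 0<c → let m , p = P-union (λ _ → ∅-closed) (λ _ → proj₁) c 0<c in
      <⇒≱ 0<c (+-cancelʳ-≤ (c + c) (begin
        c + (c + c)                              ≤⟨ x≤x+y (partialSum-nonneg (λ _ → proj₁ 0<c) m) ⟩
        c + (c + c) + partialSum (λ _ → c) m
          ≈⟨ solve 2 (λ c s → c :+ (c :+ c) :+ s := c :+ (c :+ (c :+ s)))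
            refl c (partialSum (λ _ → c) m) ⟩
        partialSum (λ _ → c) (3 ℕ.+ m)           ≤⟨ proj₂ (p (3 ℕ.+ m) (ℕ.m≤n+m m 3)) ⟩
        P (⋃ ℕ λ _ → ∅) + c       ≈⟨ +-congʳ (P-cong (⋃-closed λ _ → ∅-closed) (proj₂ , λ ())) ⟩
        c + c                                    ≈⟨ +-identityˡ _ ⟨
        0# + (c + c)                             ∎)))
    (P-nonneg ∅-closed)
    where c = P ∅

  -- The partial sums along `pairSeq A B` are constant from length 2 on, because `P ∅` vanishes, so
  -- countable additivity gives the value.
  P-∪ : ∀ {A B} → IsEvent A → IsEvent B → A ⊥ B → P (A ∪ B) ≈ P A + P B
  P-∪ {A} {B} a b A⊥B = begin-equality
    P (A ∪ B)                          ≈⟨ P-cong (⋃-closed seq-event) ⋃-pairSeq ⟨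
    P (⋃ ℕ (pairSeq A B)) ≈⟨ ⟶-eventually-const 2
        (λ n → +-congˡ (trans (+-congˡ (partialSum-zero (λ _ → P-∅) n)) (+-identityʳ _)))
        (P-union seq-event disjoint) ⟨
    P A + P B                          ∎
    where
    seq-event = pairSeq-closed a b
    disjoint : ∀ {m n} → m ≢ n → pairSeq A B m ⊥ pairSeq A B n
    disjoint {zero}        {zero}        m≢n = ⊥-elim (m≢n ≡.refl)
    disjoint {zero}        {suc zero}    m≢n = A⊥B
    disjoint {suc zero}    {zero}        m≢n = A⊥B ∘ swap
    disjoint {suc zero}    {suc zero}    m≢n = ⊥-elim (m≢n ≡.refl)
    disjoint {suc (suc _)} {_}           m≢n = proj₁
    disjoint {zero}        {suc (suc _)} m≢n = proj₂
    disjoint {suc zero}    {suc (suc _)} m≢n = proj₂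

  P-split : ∀ {A B} → IsEvent A → IsEvent B → P B ≈ P (B ∩ A) + P (B ∩ ∁ A)
  P-split {A} {B} a b = trans
    (P-cong b ((λ {ω} x → split ω x) , [ proj₁ , proj₁ ]′))
    (P-∪ (∩-closed b a) (∩-closed b (∁-closed a)) (λ { ((_ , p) , (_ , ¬p)) → ¬p p }))
    where
    split : ∀ ω → B ω → (B ∩ A ∪ B ∩ ∁ A) ω
    split ω x with em {A ω}
    ... | yes p = inj₁ (x , p)
    ... | no ¬p = inj₂ (x , ¬p)

  P-mono : ∀ {A B} → IsEvent A → IsEvent B → A ⊆ B → P A ≤ P B
  P-mono {A} {B} a b A⊆B = ≤-from-gap (P-nonneg (∩-closed b (∁-closed a)))
    (trans (P-split a b) (+-congʳ (P-cong (∩-closed b a) (proj₂ , λ x → A⊆B x , x))))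

  P≤1 : ∀ {A} → IsEvent A → P A ≤ 1#
  P≤1 a = ≤-trans (P-mono a U-closed _) (≤-reflexive P-univ)

  P-∁ : ∀ {A} → IsEvent A → P (∁ A) ≈ 1# - P A
  P-∁ {A} a = begin-equality
    P (∁ A)                         ≈⟨ solve 2 (λ p q → q := p :+ q :- p) refl (P A) (P (∁ A)) ⟩
    P A + P (∁ A) - P A
      ≈⟨ +-congʳ (+-cong (P-cong (∩-closed U-closed a) (proj₂ , (tt ,_)))
                                                         (P-cong (∩-closed U-closed (∁-closed a)) (proj₂ , (tt ,_)))) ⟨
    P (U ∩ A) + P (U ∩ ∁ A) - P A   ≈⟨ +-congʳ (P-split a U-closed) ⟨
    P U - P A                       ≈⟨ +-congʳ P-univ ⟩
    1# - P A                        ∎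

  P-∪-≤ : ∀ {A B} → IsEvent A → IsEvent B → P (A ∪ B) ≤ P A + P B
  P-∪-≤ {A} {B} a b = begin
    P (A ∪ B)                             ≈⟨ P-split a a∪b ⟩
    P ((A ∪ B) ∩ A) + P ((A ∪ B) ∩ ∁ A)   ≤⟨ +-mono-≤ (P-mono (∩-closed a∪b a) a proj₂)
        (P-mono (∩-closed a∪b (∁-closed a)) b λ { (inj₁ p , ¬p) → ⊥-elim (¬p p) ; (inj₂ q , _) → q }) ⟩
    P A + P B                             ∎
    where a∪b = ∪-closed a b

  union-bound : ∀ {n b} {A : Fin n → Pred Ω 0ℓ} → (∀ i → IsEvent (A i)) → (∀ i → P (A i) ≤ b) →
                P (λ ω → ∃[ i ] A i ω) ≤ n · b
  union-bound {zero} e p = ≤-reflexive (trans (P-cong (∃-closed e) ((λ ()) , λ ())) P-∅)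
  union-bound {suc n} {b} {A} e p = begin
    P (λ ω → ∃[ i ] A i ω)                      ≈⟨ P-cong (∃-closed e)
        ((λ { (zero , q) → inj₁ q ; (suc i , q) → inj₂ (i , q) }) , [ (zero ,_) , (λ { (i , q) → suc i , q }) ]′) ⟩
    P (A zero ∪ λ ω → ∃[ i ] A (suc i) ω)       ≤⟨ P-∪-≤ (e zero) (∃-closed (e ∘ suc)) ⟩
    P (A zero) + P (λ ω → ∃[ i ] A (suc i) ω)
      ≤⟨ +-mono-≤ (p zero) (union-bound (e ∘ suc) (p ∘ suc)) ⟩
    b + n · b                                   ∎

  -- Uniformity speaks only of intervals inside `[0,1]`, whereas `p` may exceed 1. The interval
  -- `[0,r]` has mass `r` and lies inside the event `X ω ≤ p`.
  P-uniform-tail : ∀ {X p r} → IsRandomVariable X → IsUniform[0,1] X → 0# ≤ r → r ≤ p → r ≤ 1# →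
                   P (λ ω → ¬ X ω ≤ p) ≤ 1# - r
  P-uniform-tail {X} {p} {r} rv unif 0≤r r≤p r≤1 = begin
    P (λ ω → ¬ X ω ≤ p)                        ≈⟨ P-∁ (rv (ray p)) ⟩
    1# - P (λ ω → X ω ≤ p)
      ≤⟨ ≤-from-gap (x≤y⇒0≤y-x mass)
        (solve 2 (λ m r → con (+ 1) :- r := con (+ 1) :- m :+ (m :- r)) refl _ r) ⟩
    1# - r                                     ∎
    where
    mass : r ≤ P (λ ω → X ω ≤ p)
    mass = begin
      r                                ≈⟨ solve 1 (λ r → r := r :- con (+ 0)) refl r ⟩
      r - 0#                           ≈⟨ unif ≤-refl 0≤r r≤1 ⟨
      P (λ ω → 0# ≤ X ω × X ω ≤ r)
        ≤⟨ P-mono (rv (∩-Borel nonneg-Borel (ray r))) (rv (ray p)) (λ { (_ , X≤r) → ≤-trans X≤r r≤p }) ⟩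
      P (λ ω → X ω ≤ p)                ∎

-- Products of factors in the unit interval, and minimizers over finite sets.

module ProductBounds (em : ExcludedMiddle 0ℓ) (R : CompleteOrderedField) where
  open CompleteOrderedField R hiding (zero)
  open RealProperties em R

  product-nonneg : ∀ {n} {f : Fin n → ℝ} → (∀ i → 0# ≤ f i) → 0# ≤ product f
  product-nonneg {zero}  p = 0≤1
  product-nonneg {suc n} p = *-nonneg (p zero) (product-nonneg (p ∘ suc))

  product≤1 : ∀ {n} {f : Fin n → ℝ} → (∀ i → 0# ≤ f i) → (∀ i → f i ≤ 1#) → product f ≤ 1#
  product≤1 {zero}  p q = ≤-refl
  product≤1 {suc n} p q = ≤-trans (*-mono-≤ (product-nonneg (p ∘ suc)) 0≤1 (q zero) (product≤1 (p ∘ suc) (q ∘ suc)))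
    (≤-reflexive (*-identityˡ 1#))

  product≤factor : ∀ {n} {f : Fin n → ℝ} → (∀ i → 0# ≤ f i) → (∀ i → f i ≤ 1#) → ∀ i →
    product f ≤ f i
  product≤factor {suc n} {f} p q zero = ≤-trans (*-monoˡ-≤ (p zero) (product≤1 (p ∘ suc) (q ∘ suc))) (≤-reflexive (*-identityʳ _))
  product≤factor {suc n} {f} p q (suc i) = ≤-trans
    (*-mono-≤ (product-nonneg (p ∘ suc)) 0≤1 (q zero) (product≤factor (p ∘ suc) (q ∘ suc) i)) (≤-reflexive (*-identityˡ _))

  -- Factors at indices satisfying `Q` contribute at most `q`, all others at most 1. The general `g`
  -- lets the induction shift indices; `g = id` gives the list `allFin`.
  product≤^ : ∀ {A : Set} {Q : A → Set} (Q? : Decidable Q) {n} (g : Fin n → A) {f : Fin n → ℝ} {q} →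
              0# ≤ q → (∀ i → 0# ≤ f i) → (∀ i → f i ≤ 1#) → (∀ i → Q (g i) → f i ≤ q) →
              product f ≤ q ^ length (filter Q? (tabulate g))
  product≤^ Q? {zero}  g 0≤q 0≤f f≤1 f≤q = ≤-refl
  product≤^ Q? {suc n} g 0≤q 0≤f f≤1 f≤q with Q? (g zero) | product≤^ Q? (g ∘ suc) 0≤q (0≤f ∘ suc) (f≤1 ∘ suc) (f≤q ∘ suc)
  ... | yes p | ih = *-mono-≤ (product-nonneg (0≤f ∘ suc)) 0≤q (f≤q zero p) ih
  ... | no  _ | ih = ≤-trans (*-mono-≤ (product-nonneg (0≤f ∘ suc)) 0≤1 (f≤1 zero) ih) (≤-reflexive (*-identityˡ _))

  argmin : ∀ {n} {Q : Fin n → Set} → Decidable Q → (f : Fin n → ℝ) → ∃[ i ] Q i →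
    ∃[ i ] Q i × (∀ j → Q j → f i ≤ f j)
  argmin {suc n} {Q} Q? f (i₀ , q₀) with Fin.any? (Q? ∘ suc)
  argmin {suc n} {Q} Q? f (zero , q₀)  | no ¬q = zero , q₀ , λ { zero _ → ≤-refl ; (suc j) q → ⊥-elim (¬q (j , q)) }
  argmin {suc n} {Q} Q? f (suc i , q₀) | no ¬q = ⊥-elim (¬q (i , q₀))
  ... | yes q with argmin (Q? ∘ suc) (f ∘ suc) q | Q? zero
  ...   | i , qᵢ , min | no ¬q₀ = suc i , qᵢ , λ { zero q₀ → ⊥-elim (¬q₀ q₀) ; (suc j) → min j }
  ...   | i , qᵢ , min | yes q₀ with ≤-total (f zero) (f (suc i))
  ...     | inj₁ p = zero , q₀ , λ { zero _ → ≤-refl ; (suc j) q → ≤-trans p (min j q) }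
  ...     | inj₂ p = suc i , qᵢ , λ { zero _ → p ; (suc j) → min j }

-- Equivalence of emitting all MinHashes with missing no occurring pair.

module Emission (em : ExcludedMiddle 0ℓ) (R : CompleteOrderedField) {N D : ℕ} (T : Fin N → Subset D) where
  open CompleteOrderedField R hiding (zero)
  open RealProperties em R
  open ProductBounds em R

  #-nonZero : ∀ {t w} → w ∈ T t → NonZero ((# T) w)
  #-nonZero {t} {w} w∈t = ℕ.>-nonZero (∈-length (∈-filter⁺ (λ t → w ∈? T t) (∈-allFin t) w∈t))

  threshold : ℝ → ℕ → Fin D → ℝ
  threshold c k w = (c * log (fromℕ (D ℕ.* k))) / fromℕ ((# T) w)

  -- The condition ranges over every `j′` and `t`, with `j′ ≡ j` as a premise, to match the product
  -- form of `Independent`.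
  Missed : ℝ → ∀ {k} → Fin D → Fin k → (Fin k → Fin N → ℝ) → Set
  Missed c {k} w j h = ∀ j′ t → j′ ≡ j → w ∈ T t → ¬ h j′ t ≤ threshold c k w

  -- A word in no document is missed vacuously, so occurrence is required separately.
  SomeMissed : ℝ → ∀ {k} → (Fin k → Fin N → ℝ) → Set
  SomeMissed c {k} h = ∃[ w ] ∃[ j ] (∃[ t ] w ∈ T t) × Missed c {k} w j h

  emitted⇒≤threshold : ∀ {c k} {h : Fin k → Fin N → ℝ} {t w j v} →
    MinHashSampleMap T R c h t (w , j) v → h j t ≤ threshold c k w
  emitted⇒≤threshold (emit _ _ _ p) = p

  emitsAll⇒¬missed : ∀ {c k} {h : Fin k → Fin N → ℝ} → EmitsAllMinHashes T R c h → ¬ SomeMissed c h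
  emitsAll⇒¬missed all (w , j , occurs , missed) with all w occurs j
  ... | t , w∈t , _ , emitted = missed j t ≡.refl w∈t (emitted⇒≤threshold emitted)

  -- The emitting document is one with minimal hash value: if that value were above the threshold,
  -- so would be the values of all documents containing `w`, and the pair would be missed.
  ¬missed⇒emitsAll : ∀ {c k} {h : Fin k → Fin N → ℝ} → ¬ SomeMissed c h → EmitsAllMinHashes T R c h
  ¬missed⇒emitsAll {c} {k} {h} ¬missed w occurs j with argmin (λ t → w ∈? T t) (h j) occurs
  ... | t , w∈t , minimal = t , w∈t , record { attained = t , w∈t , refl ; lowerBound = minimal } ,
    emit w j w∈t (decidable-stable em λ ≰threshold → ¬missed (w , j , occurs ,
      λ { _ s ≡.refl w∈s ≤threshold → ≰threshold (≤-trans (minimal s w∈s) ≤threshold) }))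

-- Probability of missing one pair, and the union bound over all pairs.

module MissProbability
  (em : ExcludedMiddle 0ℓ) (R : CompleteOrderedField) (𝓟 : ProbabilitySpace R)
  {N D k : ℕ} .{{_ : NonZero D}} .{{_ : NonZero k}} (T : Fin N → Subset D)
  (h : Fin k → Fin N → ProbabilitySpace.Ω 𝓟 → CompleteOrderedField.ℝ R)
  (random : ∀ j t → ProbabilitySpace.IsRandomVariable 𝓟 (h j t))
  (uniform : ∀ j t → ProbabilitySpace.IsUniform[0,1] 𝓟 (h j t))
  (independent : ProbabilitySpace.Independent 𝓟 h)
  where
  open CompleteOrderedField R hiding (zero)
  open ProbabilitySpace 𝓟
  open RealProperties em R
  open LogarithmProperties em R
  open BorelProperties em R
  open ProbabilityProperties em R 𝓟
  open ProductBounds em R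
  open Emission em R T

  c = fromℕ 3
  Dk = fromℕ (D ℕ.* k)

  1≤Dk : 1# ≤ Dk
  1≤Dk = 1≤fromℕ (D ℕ.* k) {{ℕ.m*n≢0 D k}}

  module _ (w : Fin D) (j : Fin k) where

    -- All of `ℝ` unless `j′ ≡ j` and `w ∈ T t`, in which case it is the open ray above the
    -- threshold.
    box : Fin k → Fin N → Pred ℝ 0ℓ
    box j′ t x = j′ ≡ j → w ∈ T t → ¬ x ≤ threshold c k w

    box-Borel : ∀ j′ t → Borel R (box j′ t)
    box-Borel j′ t with j′ Fin.≟ j | w ∈? T t
    ... | yes j′≡j | yes w∈t = resp ((λ p _ _ → p) , λ p → p j′≡j w∈t) (compl (ray (threshold c k w)))
    ... | no  j′≢j | _       = resp ((λ _ j′≡j → ⊥-elim (j′≢j j′≡j)) , λ _ → tt) univ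
    ... | yes _    | no  w∉t = resp ((λ _ _ w∈t → ⊥-elim (w∉t w∈t)) , λ _ → tt) univ

    factor : Fin k → Fin N → ℝ
    factor j′ t = P (λ ω → box j′ t (h j′ t ω))

    factor-event : ∀ j′ t → IsEvent (λ ω → box j′ t (h j′ t ω))
    factor-event j′ t = random j′ t (box-Borel j′ t)

    missed-event : IsEvent (λ ω → Missed c w j (λ j′ t → h j′ t ω))
    missed-event = ∀-closed λ j′ → ∀-closed λ t → factor-event j′ t

    P-missed : ∀ {t₀} → w ∈ T t₀ → P (λ ω → Missed c w j (λ j′ t → h j′ t ω)) ≤ (Dk ⁻¹) ^ 3
    P-missed w∈t₀ with truncated-threshold ((# T) w) {{#-nonZero w∈t₀}} 1≤Dk
    ... | r , 0≤r , r≤p , r≤1 , [1-r]^n≤Dk⁻³ = begin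
      P (λ ω → Missed c w j (λ j′ t → h j′ t ω))    ≈⟨ independent box box-Borel ⟩
      product (λ j′ → product (factor j′))
        -- The hash functions other than `j` contribute factors at most 1.
        ≤⟨ product≤factor (λ j′ → product-nonneg (nonneg j′)) (λ j′ → product≤1 (nonneg j′) (≤1 j′)) j ⟩
      product (factor j)
        -- With `id` as index map, the filtered list is the one whose length defines `# w`, so the
        -- exponent counts the documents containing `w`.
        ≤⟨ product≤^ (λ t → w ∈? T t) id (x≤y⇒0≤y-x r≤1) (nonneg j) (≤1 j) factor≤1-r ⟩
      (1# - r) ^ (# T) w                            ≤⟨ [1-r]^n≤Dk⁻³ ⟩
      (Dk ⁻¹) ^ 3                                   ∎
      where
      nonneg : ∀ j′ t → 0# ≤ factor j′ t
      nonneg j′ t = P-nonneg (factor-event j′ t)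
      ≤1 : ∀ j′ t → factor j′ t ≤ 1#
      ≤1 j′ t = P≤1 (factor-event j′ t)
      factor≤1-r : ∀ t → w ∈ T t → factor j t ≤ 1# - r
      factor≤1-r t w∈t = ≤-trans
        (P-mono (factor-event j t) (∁-closed (random j t (ray (threshold c k w)))) (λ p → p ≡.refl w∈t))
        (P-uniform-tail (random j t) (uniform j t) 0≤r r≤p r≤1)

    occurringMissed-event : IsEvent (λ ω → (∃[ t ] w ∈ T t) × Missed c w j (λ j′ t → h j′ t ω))
    occurringMissed-event = ∩-closed (const-closed (∃[ t ] w ∈ T t)) missed-event

    P-occurringMissed : P (λ ω → (∃[ t ] w ∈ T t) × Missed c w j (λ j′ t → h j′ t ω)) ≤ (Dk ⁻¹) ^ 3
    P-occurringMissed with em {∃[ t ] w ∈ T t}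
    ... | yes (t , w∈t) = ≤-trans (P-mono occurringMissed-event missed-event proj₂) (P-missed w∈t)
    ... | no ¬occurs    = begin
      P _           ≈⟨ P-cong occurringMissed-event ((λ { (occurs , _) → ¬occurs occurs }) , λ ()) ⟩
      P ∅           ≈⟨ P-∅ ⟩
      0#            ≤⟨ ^-nonneg (⁻¹-nonneg (<-≤-trans 0<1 1≤Dk)) 3 ⟩
      (Dk ⁻¹) ^ 3   ∎

  someMissed-event : IsEvent (λ ω → SomeMissed c (λ j t → h j t ω))
  someMissed-event = ∃-closed λ w → ∃-closed λ j → occurringMissed-event w j

  P-someMissed : P (λ ω → SomeMissed c (λ j t → h j t ω)) ≤ 1# / Dk ^ 2
  P-someMissed = begin
    P (λ ω → SomeMissed c (λ j t → h j t ω))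
      -- The bound is applied over words and then over hash functions, giving `D * k` copies of
      -- `(Dk ⁻¹) ^ 3`.
      ≤⟨ union-bound (λ w → ∃-closed (occurringMissed-event w)) (λ w → union-bound (occurringMissed-event w) (P-occurringMissed w)) ⟩
    D · (k · b)                                ≈⟨ ×-assocˡ b D k ⟩
    (D ℕ.* k) · b                              ≈⟨ ·≈fromℕ* (D ℕ.* k) b ⟩
    Dk * b
      ≈⟨ solve 2 (λ x y → let o = con (+ 1) in x :* (y :* (y :* (y :* o))) := (x :* y) :* (y :* y))
        refl Dk y ⟩
    Dk * y * (y * y)                           ≈⟨ *-congʳ xy≈1 ⟩
    1# * (y * y)                               ≈⟨ *-congˡ (⁻¹-unique x²y²≈1) ⟩
    1# / Dk ^ 2                                ∎
    where
    y = Dk ⁻¹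
    b = y ^ 3
    xy≈1 = *-inverse⁺ (<-≤-trans 0<1 1≤Dk)
    x²y²≈1 : Dk ^ 2 * (y * y) ≈ 1#
    x²y²≈1 = begin-equality
      Dk ^ 2 * (y * y)
        ≈⟨ solve 2 (λ x y → let o = con (+ 1) in (x :* (x :* o)) :* (y :* y) := (x :* y) :* (x :* y)) refl Dk y ⟩
      (Dk * y) * (Dk * y)     ≈⟨ *-cong xy≈1 xy≈1 ⟩
      1# * 1#                 ≈⟨ *-identityˡ 1# ⟩
      1#                      ∎

theorem5 :
    ExcludedMiddle 0ℓ →
    (R : CompleteOrderedField) (𝓟 : ProbabilitySpace R) →
    let open CompleteOrderedField R
        open ProbabilitySpace 𝓟 in
    (N D L k : ℕ) .{{_ : NonZero D}} .{{_ : NonZero k}}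
    (T : Fin N → Subset D) → (∀ t → ∣ T t ∣ ℕ.≤ L) →
    (h : Fin k → Fin N → Ω → ℝ) →
    (∀ j t → IsRandomVariable (h j t)) →
    (∀ j t → IsUniform[0,1] (h j t)) →
    Independent h →
    let Good = λ ω → EmitsAllMinHashes T R (fromℕ 3) (λ j t → h j t ω) in
    IsEvent Good × 1# - 1# / fromℕ (D ℕ.* k) ^ 2 ≤ P Good
theorem5 em R 𝓟 N D L k T _ h random uniform independent = ≐-closed ¬missed≐good ¬missed-event , (begin
    1# - 1# / Dk ^ 2
      ≤⟨ ≤-from-gap (x≤y⇒0≤y-x P-someMissed)
        (solve 3 (λ o a b → o :- b := o :- a :+ (a :- b)) refl 1# (1# / Dk ^ 2) _) ⟩
    1# - P someMissed          ≈⟨ P-∁ someMissed-event ⟨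
    P (∁ someMissed)           ≈⟨ P-cong ¬missed-event ¬missed≐good ⟩
    P good                     ∎)
  where
  open CompleteOrderedField R
  open ProbabilitySpace 𝓟
  open RealProperties em R
  open ProbabilityProperties em R 𝓟
  open Emission em R T
  open MissProbability em R 𝓟 T h random uniform independent
  good someMissed : Pred Ω 0ℓ
  good       ω = EmitsAllMinHashes T R (fromℕ 3) (λ j t → h j t ω)
  someMissed ω = SomeMissed (fromℕ 3) (λ j t → h j t ω)
  -- That `good` is an event comes from its pointwise equivalence with the complement of
  -- `someMissed`, which also transfers the probability.
  ¬missed-event = ∁-closed someMissed-event
  ¬missed≐good : ∁ someMissed ≐ good
  ¬missed≐good = ¬missed⇒emitsAll , emitsAll⇒¬missed
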